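{- Let $(a_n)_{n\ge 0}$ and $(b_n)_{n\ge 0}$ be sequences with $a_n\neq 0$ and $b_n\neq 0$ for all $n$, and let $t$ be an indeterminate. Let $(x_n)_{n\ge 0}$ be a sequence satisfying, for all $n\geq 0$, $$x_{n+2}=a_nx_{n+1}+b_nx_{n}.$$ Then the following two identities hold for every $n=0,1,2,\dots$, provided the denominators appearing in them are not $0$: $$\sum_{k=1}^n \frac{t^{k-1}}{a_0a_1\cdots a_{k-1}}\cdot\frac{b_{k-1}x_{k-1}+(t-1)x_{k+1}}{x_1}=\frac{t^n}{a_0a_1\cdots a_{n-1}}\cdot\frac{x_{n+1}}{x_1}-1,$$ $$\sum_{k=1}^n \frac{(-1)^k}{t^k}\cdot\frac{a_1a_2\cdots a_{k-1}}{b_1b_2\cdots b_k}\cdot\frac{x_{k+2}+(t-1)b_kx_{k}}{x_1}=\frac{(-1)^n}{t^n}\cdot\frac{a_1a_2\cdots a_{n}}{b_1b_2\cdots b_n}\cdot\frac{x_{n+1}}{x_1}-1.$$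
   Context: The entries of the sequences $a_n$, $b_n$ (and $x_n$), and $t$, are indeterminates that may be specialized to complex numbers or polynomials; the identities can thus be read in a field containing all these quantities. Empty products (such as $a_0\cdots a_{n-1}$ for $n=0$, or $a_1\cdots a_{k-1}$ for $k=1$) equal $1$, and empty sums equal $0$. -}

module Defs where

open import Algebra.Apartness.Bundles using (HeytingCommutativeRing; HeytingField)
open import Algebra.Bundles using (CommutativeRing; Semiring)
import Algebra.Apartness.Properties.HeytingCommutativeRing as HeytingProperties
import Algebra.Definitions.RawSemiring as RawSemiringDefinitions
import Algebra.Properties.Monoid.Sum as MonoidSum
open import Data.Fin.Base using (toℕ)
open import Data.Nat.Base using (ℕ; zero; suc)
open import Data.Product.Base using (proj₁)

-- The base field is a Heyting field: "nonzero" is apartness from 0#, which is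
-- equivalent to invertibility. For a field with decidable equality, _#_ is
-- the negation of _≈_.
module FieldOperations {c ℓ₁ ℓ₂} (K : HeytingField c ℓ₁ ℓ₂) where

  open HeytingField K
  open HeytingProperties heytingCommutativeRing using (1#0; x#0y#0→xy#0)

  open HeytingCommutativeRing heytingCommutativeRing using (commutativeRing)
  open CommutativeRing commutativeRing using (semiring; +-monoid)
  open Semiring semiring using (rawSemiring)
  open RawSemiringDefinitions rawSemiring public using (_^_; product)
  open MonoidSum +-monoid public using (sum-syntax)

  infixl 7 _/_[_]

  -- #⇒invertible inverts y - 0#, which is equal to y.
  _/_[_] : (x y : Carrier) → y # 0# → Carrier
  x / y [ y#0 ] = x * proj₁ (#⇒invertible y#0)

  ∏-syntax : (n : ℕ) → (ℕ → Carrier) → Carrier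
  ∏-syntax n f = product {n} (λ j → f (toℕ j))

  infixl 10 ∏-syntax
  syntax ∏-syntax n (λ j → e) = ∏[ j < n ] e

  ∏#0 : ∀ n {f : ℕ → Carrier} → (∀ j → f j # 0#) → (∏[ j < n ] f j) # 0#
  ∏#0 zero    f#0 = 1#0
  ∏#0 (suc n) f#0 = x#0y#0→xy#0 (f#0 0) (∏#0 n (λ j → f#0 (suc j)))

{-# OPTIONS --safe #-}

-- Both sums telescope. By the recurrence, the summand with index k is
-- F k - F (k - 1), where F n is the right-hand side without the final - 1,
-- and F 0 = 1. Subtractions are moved to the other side, so that each step
-- becomes a semiring identity.

module Submission where

open import Defs
open import Algebra.Apartness.Bundles using (HeytingField; HeytingCommutativeRing)
open import Algebra.Bundles using (CommutativeRing)
import Algebra.Apartness.Properties.HeytingCommutativeRing as HeytingProperties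
import Algebra.Properties.Ring as RingProperties
import Algebra.Solver.Ring.NaturalCoefficients.Default as NaturalCoefficients
open import Data.Fin.Base using (toℕ)
open import Data.Fin.Properties using (toℕ<n)
open import Data.Nat.Base using (ℕ; zero; suc; _≤_; _<_; z≤n; s≤s)
open import Data.Nat.Properties using (≤-refl)
open import Data.Product.Base using (_×_; _,_; proj₁; proj₂)
import Relation.Binary.Reasoning.Setoid as SetoidReasoning

module FieldProperties {c ℓ₁ ℓ₂} (K : HeytingField c ℓ₁ ℓ₂) where

  open HeytingField K
  open FieldOperations K
  open HeytingProperties heytingCommutativeRing using (x-0≈x)
  open HeytingCommutativeRing heytingCommutativeRing using (commutativeRing)
  open CommutativeRing commutativeRing using (ring; commutativeSemiring)
  open RingProperties ring using (x≈z//y; //-rightDividesˡ)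
  open NaturalCoefficients commutativeSemiring
  open SetoidReasoning setoid

  infix 8 1/[_]

  1/[_] : ∀ {y} → y # 0# → Carrier
  1/[ y#0 ] = proj₁ (#⇒invertible y#0)

  *-1/ : ∀ {y} (y#0 : y # 0#) → y * 1/[ y#0 ] ≈ 1#
  *-1/ {y} y#0 = trans (*-congʳ (sym (x-0≈x y))) (proj₂ (proj₂ (#⇒invertible y#0)))

  -- The inverse of a factor is the cofactor times the inverse of the product: multiply by
  -- `z * 1/[ z#0 ]` and cancel `y`. This puts two successive terms over the larger denominator,
  -- leaving one inverse that can be treated as an atom.
  1/-factor : ∀ {y z w} (y#0 : y # 0#) (z#0 : z # 0#) → z ≈ w * y →
              1/[ y#0 ] ≈ w * 1/[ z#0 ]
  1/-factor {y} {z} {w} y#0 z#0 z≈wy = begin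
    1/[ y#0 ]                         ≈⟨ *-identityʳ _ ⟨
    1/[ y#0 ] * 1#                    ≈⟨ *-congˡ (*-1/ z#0) ⟨
    1/[ y#0 ] * (z * 1/[ z#0 ])       ≈⟨ *-congˡ (*-congʳ z≈wy) ⟩
    1/[ y#0 ] * (w * y * 1/[ z#0 ])   ≈⟨ solve 4 (λ u w y v → u :* (w :* y :* v) := (y :* u) :* (w :* v)) refl _ _ _ _ ⟩
    (y * 1/[ y#0 ]) * (w * 1/[ z#0 ]) ≈⟨ *-congʳ (*-1/ y#0) ⟩
    1# * (w * 1/[ z#0 ])              ≈⟨ *-identityˡ _ ⟩
    w * 1/[ z#0 ]                     ∎

  1/1≈1 : (1#0 : 1# # 0#) → 1# / 1# [ 1#0 ] ≈ 1#
  1/1≈1 = *-1/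

  -- `product` unfolds at its first factor, whereas going from index `k` to `suc k` appends a last
  -- one; induction commutes that factor past the first.
  ∏-last : ∀ n (f : ℕ → Carrier) → ∏[ j < suc n ] f j ≈ f n * ∏[ j < n ] f j
  ∏-last zero    f = refl
  ∏-last (suc n) f = begin
    f 0 * ∏[ j < suc n ] f (suc j)             ≈⟨ *-congˡ (∏-last n (λ j → f (suc j))) ⟩
    f 0 * (f (suc n) * ∏[ j < n ] f (suc j))   ≈⟨ solve 3 (λ u v w → u :* (v :* w) := v :* (u :* w)) refl _ _ _ ⟩
    f (suc n) * (f 0 * ∏[ j < n ] f (suc j))   ∎

  -- The bounds are arguments of f and F because the terms of the second
  -- identity contain proofs that t ^ k is apart from zero, given only for k ≤ n.
  telescope : ∀ n (f : ∀ k → k < n → Carrier) (F : ∀ k → k ≤ n → Carrier) →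
              (∀ k (k<n : k < n) (k≤n : k ≤ n) → f k k<n + F k k≤n ≈ F (suc k) k<n) →
              ∀ n≤n → ∑[ i < n ] f (toℕ i) (toℕ<n i) + F 0 z≤n ≈ F n n≤n
  telescope zero    f F step z≤n       = +-identityˡ _
  telescope (suc n) f F step (s≤s n≤n) = begin
    (f 0 _ + ∑f) + F 0 z≤n ≈⟨ solve 3 (λ u v w → (u :+ v) :+ w := v :+ (u :+ w)) refl _ _ _ ⟩
    ∑f + (f 0 _ + F 0 z≤n) ≈⟨ +-congˡ (step 0 _ z≤n) ⟩
    -- The sum also unfolds at its first summand, so the induction hypothesis is applied to both
    -- sequences shifted by one, with `F 1` as the new initial value.
    ∑f + F 1 _             ≈⟨ telescope n (λ k k<n → f (suc k) (s≤s k<n)) (λ k k≤n → F (suc k) (s≤s k≤n))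
                                (λ k k<n k≤n → step (suc k) (s≤s k<n) (s≤s k≤n)) n≤n ⟩
    F (suc n) (s≤s n≤n)    ∎
    where ∑f = ∑[ i < n ] f (suc (toℕ i)) (s≤s (toℕ<n i))

  telescope-from-1 : ∀ n (f : ∀ k → k < n → Carrier) (F : ∀ k → k ≤ n → Carrier) →
                     F 0 z≤n ≈ 1# →
                     (∀ k (k<n : k < n) (k≤n : k ≤ n) → f k k<n + F k k≤n ≈ F (suc k) k<n) →
                     ∀ n≤n → ∑[ i < n ] f (toℕ i) (toℕ<n i) ≈ F n n≤n - 1#
  telescope-from-1 n f F F0≈1 step n≤n =
    x≈z//y _ _ _ (trans (+-congˡ (sym F0≈1)) (telescope n f F step n≤n))

  -- With `t` written this way, `t - 1#` becomes an atom `m` for the semiring solver, which has no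
  -- subtraction.
  ≈1+[-1] : ∀ t → t ≈ 1# + (t - 1#)
  ≈1+[-1] t = trans (sym (//-rightDividesˡ 1# t)) (+-comm _ _)

  module Recurrence
    (a b : ℕ → Carrier) (a#0 : ∀ n → a n # 0#) (b#0 : ∀ n → b n # 0#)
    (t : Carrier) (x : ℕ → Carrier)
    (rec : ∀ n → x (suc (suc n)) ≈ a n * x (suc n) + b n * x n)
    (x₁#0 : x 1 # 0#)
    where

    F₁ : ℕ → Carrier
    F₁ n = (t ^ n / ∏[ j < n ] a j [ ∏#0 n a#0 ]) * (x (suc n) / x 1 [ x₁#0 ])

    -- Indexed from 0: term₁ k, like term₂ k below, is the summand with index k + 1.
    term₁ : ℕ → Carrier
    term₁ k = (t ^ k / ∏[ j < suc k ] a j [ ∏#0 (suc k) a#0 ])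
              * ((b k * x k + (t - 1#) * x (suc (suc k))) / x 1 [ x₁#0 ])

    F₁-zero : F₁ 0 ≈ 1#
    F₁-zero = trans (*-cong (1/1≈1 _) (*-1/ x₁#0)) (*-identityˡ 1#)

    F₁-step : ∀ k → term₁ k + F₁ k ≈ F₁ (suc k)
    F₁-step k = begin
      s * A′ * ((β * x₀ + m * x₂) * v) + s * A * (x₁ * v)
        ≈⟨ +-cong (*-congˡ (*-congʳ (+-congˡ (*-congˡ (rec k)))))
                  (*-congʳ (*-congˡ (1/-factor (∏#0 k a#0) (∏#0 (suc k) a#0) (∏-last k a)))) ⟩
      s * A′ * ((β * x₀ + m * (α * x₁ + β * x₀)) * v) + s * (α * A′) * (x₁ * v)
        -- `F₁ k` contributes the `α * x₁` that completes `β * x₀` to `α * x₁ + β * x₀`; together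
        -- with `m` copies of the same expression this gives the factor `1# + m`, which is `t`.
        ≈⟨ solve 8 (λ s A′ α β x₀ x₁ m v →
             s :* A′ :* ((β :* x₀ :+ m :* (α :* x₁ :+ β :* x₀)) :* v) :+ s :* (α :* A′) :* (x₁ :* v)
             := (con 1 :+ m) :* s :* A′ :* ((α :* x₁ :+ β :* x₀) :* v)) refl s A′ α β x₀ x₁ m v ⟩
      (1# + m) * s * A′ * ((α * x₁ + β * x₀) * v)
        ≈⟨ *-cong (*-congʳ (*-congʳ (≈1+[-1] t))) (*-congʳ (rec k)) ⟨
      t * s * A′ * (x₂ * v) ∎
      where
      s = t ^ k
      m = t - 1#
      v = 1/[ x₁#0 ]
      A = 1/[ ∏#0 k a#0 ]
      A′ = 1/[ ∏#0 (suc k) a#0 ]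
      α = a k
      β = b k
      x₀ = x k
      x₁ = x (suc k)
      x₂ = x (suc (suc k))

    module _ (n : ℕ) (tᵏ#0 : ∀ k → k ≤ n → t ^ k # 0#) where

      b⁺#0 : ∀ k → ∏[ j < k ] b (suc j) # 0#
      b⁺#0 k = ∏#0 k (λ j → b#0 (suc j))

      F₂ : ∀ k → k ≤ n → Carrier
      F₂ k k≤n = ((- 1#) ^ k / t ^ k [ tᵏ#0 k k≤n ])
                 * (∏[ j < k ] a (suc j) / ∏[ j < k ] b (suc j) [ b⁺#0 k ])
                 * (x (suc k) / x 1 [ x₁#0 ])

      term₂ : ∀ k → k < n → Carrier
      term₂ k k<n = ((- 1#) ^ suc k / t ^ suc k [ tᵏ#0 (suc k) k<n ])
                    * (∏[ j < k ] a (suc j) / ∏[ j < suc k ] b (suc j) [ b⁺#0 (suc k) ])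
                    * ((x (suc (suc (suc k))) + (t - 1#) * (b (suc k) * x (suc k))) / x 1 [ x₁#0 ])

      F₂-zero : F₂ 0 z≤n ≈ 1#
      F₂-zero = begin
        (1# / 1# [ tᵏ#0 0 z≤n ]) * (1# / 1# [ b⁺#0 0 ]) * (x 1 / x 1 [ x₁#0 ])
          ≈⟨ *-cong (*-cong (1/1≈1 _) (1/1≈1 _)) (*-1/ x₁#0) ⟩
        1# * 1# * 1# ≈⟨ trans (*-identityʳ _) (*-identityʳ _) ⟩
        1#           ∎

      F₂-step : ∀ k (k<n : k < n) (k≤n : k ≤ n) → term₂ k k<n + F₂ k k≤n ≈ F₂ (suc k) k<n
      F₂-step k k<n k≤n = begin
        ν * e * T′ * (A * B′) * ((x₂ + m * (β * x₀)) * v) + e * T * (A * B) * (x₀ * v)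
          ≈⟨ +-cong (*-congˡ (*-congʳ (+-congʳ (rec (suc k)))))
                    (*-congʳ (*-cong (*-congˡ T-factor) (*-congˡ B-factor))) ⟩
        ν * e * T′ * (A * B′) * ((α * x₁ + β * x₀ + m * (β * x₀)) * v)
        + e * ((1# + m) * T′) * (A * (β * B′)) * (x₀ * v)
          -- The sign `ν` is an atom for the solver. The `x₀` part of the summand is `ν` times
          -- `F₂ k` over the common denominators, so adding `F₂ k` leaves the coefficient `1# + ν`;
          -- the `α * x₁` part is what becomes `F₂ (suc k)`.
          ≈⟨ solve 11 (λ ν e T′ A B′ α β x₀ x₁ m v →
               ν :* e :* T′ :* (A :* B′) :* ((α :* x₁ :+ β :* x₀ :+ m :* (β :* x₀)) :* v)
               :+ e :* ((con 1 :+ m) :* T′) :* (A :* (β :* B′)) :* (x₀ :* v)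
               := ν :* e :* T′ :* ((α :* A) :* B′) :* (x₁ :* v)
                  :+ (con 1 :+ ν) :* (e :* ((con 1 :+ m) :* T′) :* (A :* (β :* B′)) :* (x₀ :* v)))
               refl ν e T′ A B′ α β x₀ x₁ m v ⟩
        ν * e * T′ * ((α * A) * B′) * (x₁ * v) + (1# + ν) * _
          -- Only here is `ν` used as the negative of one: `1# + ν` vanishes.
          ≈⟨ +-congˡ (trans (*-congʳ (-‿inverseʳ 1#)) (zeroˡ _)) ⟩
        ν * e * T′ * ((α * A) * B′) * (x₁ * v) + 0#
          ≈⟨ +-identityʳ _ ⟩
        ν * e * T′ * ((α * A) * B′) * (x₁ * v)
          ≈⟨ *-congʳ (*-congˡ (*-congʳ (∏-last k (λ j → a (suc j))))) ⟨
        ν * e * T′ * (A′ * B′) * (x₁ * v) ∎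
        where
        ν = - 1#
        e = (- 1#) ^ k
        m = t - 1#
        v = 1/[ x₁#0 ]
        T = 1/[ tᵏ#0 k k≤n ]
        T′ = 1/[ tᵏ#0 (suc k) k<n ]
        A = ∏[ j < k ] a (suc j)
        A′ = ∏[ j < suc k ] a (suc j)
        B = 1/[ b⁺#0 k ]
        B′ = 1/[ b⁺#0 (suc k) ]
        α = a (suc k)
        β = b (suc k)
        x₀ = x (suc k)
        x₁ = x (suc (suc k))
        x₂ = x (suc (suc (suc k)))

        T-factor : T ≈ (1# + m) * T′
        T-factor = 1/-factor (tᵏ#0 k k≤n) (tᵏ#0 (suc k) k<n) (*-congʳ (≈1+[-1] t))

        B-factor : B ≈ β * B′
        B-factor = 1/-factor (b⁺#0 k) (b⁺#0 (suc k)) (∏-last k (λ j → b (suc j)))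

theorem2p1 :
  ∀ {c ℓ₁ ℓ₂} (K : HeytingField c ℓ₁ ℓ₂) →
  let open HeytingField K
      open FieldOperations K
  in
  (a b : ℕ → Carrier) (a#0 : ∀ n → a n # 0#) (b#0 : ∀ n → b n # 0#)
  (t : Carrier) (x : ℕ → Carrier) →
  (∀ n → x (suc (suc n)) ≈ a n * x (suc n) + b n * x n) →
  (x₁#0 : x 1 # 0#) →
  (∀ n →
    ∑[ i < n ]
      (let k-1 = toℕ i
           k   = suc k-1
       in (t ^ k-1 / ∏[ j < k ] a j [ ∏#0 k a#0 ])
          * ((b k-1 * x k-1 + (t - 1#) * x (suc k)) / x 1 [ x₁#0 ]))
    ≈ (t ^ n / ∏[ j < n ] a j [ ∏#0 n a#0 ]) * (x (suc n) / x 1 [ x₁#0 ]) - 1#)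
  ×
  (∀ n (tᵏ#0 : ∀ k → k ≤ n → t ^ k # 0#) →
    ∑[ i < n ]
      (let k-1 = toℕ i
           k   = suc k-1
       in ((- 1#) ^ k / t ^ k [ tᵏ#0 k (toℕ<n i) ])
          * (∏[ j < k-1 ] a (suc j) / ∏[ j < k ] b (suc j) [ ∏#0 k (λ j → b#0 (suc j)) ])
          * ((x (suc (suc k)) + (t - 1#) * (b k * x k)) / x 1 [ x₁#0 ]))
    ≈ ((- 1#) ^ n / t ^ n [ tᵏ#0 n ≤-refl ])
      * (∏[ j < n ] a (suc j) / ∏[ j < n ] b (suc j) [ ∏#0 n (λ j → b#0 (suc j)) ])
      * (x (suc n) / x 1 [ x₁#0 ]) - 1#)
theorem2p1 K a b a#0 b#0 t x rec x₁#0 =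
  -- The denominators of the first identity contain no power of `t`, so its terms are constant in
  -- the bounds.
  (λ n → telescope-from-1 n (λ k _ → term₁ k) (λ k _ → F₁ k) F₁-zero (λ k _ _ → F₁-step k) ≤-refl) ,
  (λ n tᵏ#0 → telescope-from-1 n (term₂ n tᵏ#0) (F₂ n tᵏ#0) (F₂-zero n tᵏ#0) (F₂-step n tᵏ#0) ≤-refl)
  where
  open FieldProperties K
  open Recurrence a b a#0 b#0 t x rec x₁#0
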